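{- There is an absolute constant $C>0$ such that for every integer $n\ge 2$, every $\delta>0$, and every $2$-LCS $\mathcal S$ on $[n]$ with error-tolerance $\delta$, we have $\mathrm{rank}(\mathcal S)\le C\cdot\frac{1}{\delta}\log_2 n$.
   Context: A spanoid $\mathcal S$ on $[n]=\{1,\dots,n\}$ is a family of pairs $(S,i)$ with $S\subseteq[n]$, $i\in[n]$ (called rules, written $S\to i$). For $T\subseteq[n]$ and $i\in[n]$ write $T\models i$ if there is a sequence $T=T_0,T_1,\dots,T_r$ ($r\ge 0$) with $i\in T_r$ such that for each $j\in[r]$, $T_j=T_{j-1}\cup\{i_j\}$ for some $i_j\in[n]$ for which there is $S\subseteq T_{j-1}$ with $(S,i_j)\in\mathcal S$. The span of $T$ is $\mathrm{span}(T)=\{i: T\models i\}$, and $\mathrm{rank}(\mathcal S)$ is the minimum size of a set $T\subseteq[n]$ with $\mathrm{span}(T)=[n]$. A spanoid $\mathcal S$ on $[n]$ is a $q$-LCS with error-tolerance $\delta$ if for every $i\in[n]$ there is a family $M_i$ of at least $\delta n$ pairwise disjoint $q$-element subsets of $[n]$ such that $(S,i)\in\mathcal S$ for every $S\in M_i$. -}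

module Defs where

open import Data.Nat using (ℕ; _*_; _≤_)
open import Data.Fin using (Fin)
open import Data.Fin.Subset using (Subset; _∈_; _⊆_; _∪_; ⁅_⁆; ∣_∣; Empty; _∩_)
open import Data.List using (List; length)
open import Data.List.Relation.Unary.All using (All)
open import Data.List.Relation.Unary.AllPairs using (AllPairs)
open import Data.Product using (Σ; _×_; ∃-syntax)
open import Relation.Binary.PropositionalEquality using (_≡_)

-- A spanoid on [n] = Fin n: a family of rules (S , i), given as a predicate.
Spanoid : ℕ → Set₁
Spanoid n = Subset n → Fin n → Set

data Reach {n : ℕ} (𝒮 : Spanoid n) (T : Subset n) : Subset n → Set where
  start : Reach 𝒮 T T
  step  : ∀ {U S j} → Reach 𝒮 T U → S ⊆ U → 𝒮 S j → Reach 𝒮 T (U ∪ ⁅ j ⁆)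

_⊨[_]_ : ∀ {n} → Subset n → Spanoid n → Fin n → Set
T ⊨[ 𝒮 ] i = ∃[ U ] (Reach 𝒮 T U × i ∈ U)

Spans : ∀ {n} → Spanoid n → Subset n → Set
Spans 𝒮 T = ∀ i → T ⊨[ 𝒮 ] i

Disjoint : ∀ {n} → Subset n → Subset n → Set
Disjoint A B = Empty (A ∩ B)

-- 𝒮 is a q-LCS with error tolerance δ = a / b  (a , b positive naturals):
-- for every i there is a family M_i of pairwise disjoint q-element subsets,
-- each a rule for i, with |M_i| ≥ δ n, i.e. a * n ≤ |M_i| * b.
IsLCS : ∀ {n} → Spanoid n → (q a b : ℕ) → Set
IsLCS {n} 𝒮 q a b = ∀ (i : Fin n) → Σ (List (Subset n)) λ M →
    All (λ S → ∣ S ∣ ≡ q) M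
  × AllPairs Disjoint M
  × All (λ S → 𝒮 S i) M
  × a * n ≤ length M * b

{-# OPTIONS --safe #-}

-- Keep a set A of chosen elements and a set B of roots such that every j is
-- spanned by A together with a single root r j; initially A = ∅ and B = [n].
-- For a root b, each pair {j , k} of M b either has r j = b or else makes b
-- spanned by A ∪ {k} and the root r j ≠ b.  Double counting gives one k that is
-- selected for at least δ∣B∣ roots b, and r k = b for only one of them.  Each of
-- the others is reached from a different root, which is either larger or smaller;
-- the roots of the more frequent kind can be deleted from B once k joins A.
-- So ∣B∣ drops by a factor 1 - Ω(δ) with each new element of A, and after
-- O(log n / δ) rounds ∣B∣ = O(1 / δ), when A ∪ B is a spanning set.
module Submission where

open import Defs
open import Data.Nat using (ℕ; _*_; _^_; _≤_; _<_)
open import Data.Product using (Σ; _×_; ∃-syntax)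
open import Data.Fin.Subset using (∣_∣)

open import Algebra.Properties.Semiring.Sum as Sum using ()
open import Data.Bool using (Bool; true; false; _∧_)
open import Data.Empty using (⊥-elim)
open import Data.Fin using (Fin; zero; suc) renaming (_<_ to _<ᶠ_; _>_ to _>ᶠ_)
open import Data.Fin.Induction using (<-wellFounded; >-wellFounded)
open import Data.Fin.Properties using (<-cmp) renaming (_≟_ to _≟ᶠ_)
open import Data.Fin.Subset
  using (Subset; inside; outside; _∈_; _∉_; _⊆_; _∪_; _─_; ⁅_⁆; ⊥; ⊤)
open import Data.Fin.Subset.Properties
open import Data.List using (List; []; _∷_; length)
open import Data.List.Membership.Propositional using () renaming (_∈_ to _∈ˡ_)
open import Data.List.Relation.Unary.All as All using (All; []; _∷_)
open import Data.List.Relation.Unary.AllPairs using (AllPairs; []; _∷_)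
open import Data.List.Relation.Unary.Any using (here; there)
open import Data.Nat using (zero; suc; _+_; z≤n; s≤s; _≤?_; _/_; _%_; >-nonZero)
open import Data.Nat.DivMod using (m/n*n≤m; m%n<n; m≡m%n+[m/n]*n)
open import Data.Nat.Properties hiding (<-cmp)
open import Data.Nat.Tactic.RingSolver using (solve-∀)
open import Data.Product using (_,_; proj₁; proj₂; ∃₂)
open import Data.Sum using (_⊎_; inj₁; inj₂)
open import Data.Unit using (tt) renaming (⊤ to 𝟙)
open import Data.Vec using ([]; _∷_; here; there; lookup; tabulate)
open import Data.Vec.Properties using (lookup∘tabulate; []=⇒lookup; lookup⇒[]=)
open import Function using (_∘_; id)
open import Induction.WellFounded using (WellFounded; Acc; acc)
open import Relation.Binary.Definitions using (tri<; tri≈; tri>)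
open import Relation.Binary.PropositionalEquality
  using (_≡_; _≢_; refl; sym; trans; cong; subst)
open import Relation.Nullary using (yes; no)

open Sum +-*-semiring using (sum; sum-cong-≗; *-distribʳ-sum; ∑-comm; sum-syntax)

-- Cardinalities of finite subsets

∣p∪q∣≤∣p∣+∣q∣ : ∀ {n} (p q : Subset n) → ∣ p ∪ q ∣ ≤ ∣ p ∣ + ∣ q ∣
∣p∪q∣≤∣p∣+∣q∣ []            []            = z≤n
∣p∪q∣≤∣p∣+∣q∣ (outside ∷ p) (outside ∷ q) = ∣p∪q∣≤∣p∣+∣q∣ p q
∣p∪q∣≤∣p∣+∣q∣ (outside ∷ p) (inside  ∷ q) =
  ≤-trans (s≤s (∣p∪q∣≤∣p∣+∣q∣ p q)) (≤-reflexive (sym (+-suc ∣ p ∣ ∣ q ∣)))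
∣p∪q∣≤∣p∣+∣q∣ (inside  ∷ p) (outside ∷ q) = s≤s (∣p∪q∣≤∣p∣+∣q∣ p q)
∣p∪q∣≤∣p∣+∣q∣ (inside  ∷ p) (inside  ∷ q) =
  s≤s (≤-trans (∣p∪q∣≤∣p∣+∣q∣ p q) (+-monoʳ-≤ ∣ p ∣ (n≤1+n ∣ q ∣)))

∣p∪⁅x⁆∣≤1+∣p∣ : ∀ {n} (p : Subset n) x → ∣ p ∪ ⁅ x ⁆ ∣ ≤ suc ∣ p ∣
∣p∪⁅x⁆∣≤1+∣p∣ p x = begin
  ∣ p ∪ ⁅ x ⁆ ∣     ≤⟨ ∣p∪q∣≤∣p∣+∣q∣ p ⁅ x ⁆ ⟩
  ∣ p ∣ + ∣ ⁅ x ⁆ ∣ ≡⟨ cong (∣ p ∣ +_) (∣⁅x⁆∣≡1 x) ⟩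
  ∣ p ∣ + 1         ≡⟨ +-comm ∣ p ∣ 1 ⟩
  suc ∣ p ∣         ∎
  where open ≤-Reasoning

x∉p⇒∣p∣<∣p∪⁅x⁆∣ : ∀ {n} (p : Subset n) {x} → x ∉ p → ∣ p ∣ < ∣ p ∪ ⁅ x ⁆ ∣
x∉p⇒∣p∣<∣p∪⁅x⁆∣ p {x} x∉p =
  p⊂q⇒∣p∣<∣q∣ (p⊆p∪q ⁅ x ⁆ , x , q⊆p∪q p ⁅ x ⁆ (x∈⁅x⁆ x) , x∉p)

q⊆p⇒∣p─q∣+∣q∣≡∣p∣ : ∀ {n} (p q : Subset n) → q ⊆ p → ∣ p ─ q ∣ + ∣ q ∣ ≡ ∣ p ∣
q⊆p⇒∣p─q∣+∣q∣≡∣p∣ []            []            _   = refl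
q⊆p⇒∣p─q∣+∣q∣≡∣p∣ (outside ∷ p) (outside ∷ q) q⊆p = q⊆p⇒∣p─q∣+∣q∣≡∣p∣ p q (drop-∷-⊆ q⊆p)
q⊆p⇒∣p─q∣+∣q∣≡∣p∣ (outside ∷ p) (inside  ∷ q) q⊆p with () ← q⊆p here
q⊆p⇒∣p─q∣+∣q∣≡∣p∣ (inside  ∷ p) (outside ∷ q) q⊆p =
  cong suc (q⊆p⇒∣p─q∣+∣q∣≡∣p∣ p q (drop-∷-⊆ q⊆p))
q⊆p⇒∣p─q∣+∣q∣≡∣p∣ (inside  ∷ p) (inside  ∷ q) q⊆p =
  trans (+-suc ∣ p ─ q ∣ ∣ q ∣) (cong suc (q⊆p⇒∣p─q∣+∣q∣≡∣p∣ p q (drop-∷-⊆ q⊆p)))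

x∈p⇒0<∣p∣ : ∀ {n} {p : Subset n} {x} → x ∈ p → 0 < ∣ p ∣
x∈p⇒0<∣p∣ {p = p} {x} x∈p =
  ≤-trans (≤-reflexive (sym (∣⁅x⁆∣≡1 x)))
          (p⊆q⇒∣p∣≤∣q∣ (λ y∈ → subst (_∈ p) (sym (x∈⁅y⁆⇒x≡y x y∈)) x∈p))

all≡⇒∣p∣≤1 : ∀ {n} (p : Subset n) c → (∀ {x} → x ∈ p → c ≡ x) → ∣ p ∣ ≤ 1
all≡⇒∣p∣≤1 p c all≡ =
  ≤-trans (p⊆q⇒∣p∣≤∣q∣ (λ x∈p → subst (_∈ ⁅ c ⁆) (all≡ x∈p) (x∈⁅x⁆ c)))
          (≤-reflexive (∣⁅x⁆∣≡1 c))

∣p∣≡0⇒x∉p : ∀ {n} (p : Subset n) → ∣ p ∣ ≡ 0 → ∀ {x} → x ∉ p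
∣p∣≡0⇒x∉p p ∣p∣≡0 x∈p = <-irrefl (sym ∣p∣≡0) (x∈p⇒0<∣p∣ x∈p)

∣p∣≡1⇒singleton : ∀ {n} (p : Subset n) → ∣ p ∣ ≡ 1 →
                  ∃[ k ] (k ∈ p × (∀ {x} → x ∈ p → x ≡ k))
∣p∣≡1⇒singleton (outside ∷ p) ∣p∣≡1 with ∣p∣≡1⇒singleton p ∣p∣≡1
... | k , k∈p , only = suc k , there k∈p , λ where (there x∈p) → cong suc (only x∈p)
∣p∣≡1⇒singleton (inside ∷ p) ∣p∣≡1 = zero , here , λ where
  here        → refl
  (there x∈p) → ⊥-elim (∣p∣≡0⇒x∉p p (suc-injective ∣p∣≡1) x∈p)

∣p∣≡2⇒pair : ∀ {n} (p : Subset n) → ∣ p ∣ ≡ 2 →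
             ∃₂ λ j k → j ∈ p × k ∈ p × (∀ {x} → x ∈ p → x ≡ j ⊎ x ≡ k)
∣p∣≡2⇒pair (outside ∷ p) ∣p∣≡2 with ∣p∣≡2⇒pair p ∣p∣≡2
... | j , k , j∈p , k∈p , only = suc j , suc k , there j∈p , there k∈p , only′
  where
  only′ : ∀ {x} → x ∈ outside ∷ p → x ≡ suc j ⊎ x ≡ suc k
  only′ (there x∈p) with only x∈p
  ... | inj₁ refl = inj₁ refl
  ... | inj₂ refl = inj₂ refl
∣p∣≡2⇒pair (inside ∷ p) ∣p∣≡2 with ∣p∣≡1⇒singleton p (suc-injective ∣p∣≡2)
... | k , k∈p , only = zero , suc k , here , there k∈p , λ where
  here        → inj₁ refl
  (there x∈p) → inj₂ (cong suc (only x∈p))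

-- `P` and `Q` are arbitrary types with no decision procedure, so the side of each x is read off
-- from the proof of the disjunction.
split : ∀ {n} {P Q : Fin n → Set} (p : Subset n) → (∀ {x} → x ∈ p → P x ⊎ Q x) →
        ∃₂ λ y z → ∣ p ∣ ≡ ∣ y ∣ + ∣ z ∣
                 × (∀ {x} → x ∈ y → P x) × (∀ {x} → x ∈ z → Q x)
split [] _ = [] , [] , refl , (λ ()) , (λ ())
split (outside ∷ p) PQ with split p (PQ ∘ there)
... | y , z , eq , Py , Qz = outside ∷ y , outside ∷ z , eq ,
  (λ where (there x∈y) → Py x∈y) , (λ where (there x∈z) → Qz x∈z)
split (inside ∷ p) PQ with PQ here | split p (PQ ∘ there)
... | inj₁ P0 | y , z , eq , Py , Qz = inside ∷ y , outside ∷ z , cong suc eq ,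
  (λ where here → P0
           (there x∈y) → Py x∈y) ,
  (λ where (there x∈z) → Qz x∈z)
... | inj₂ Q0 | y , z , eq , Py , Qz = outside ∷ y , inside ∷ z ,
  trans (cong suc eq) (sym (+-suc ∣ y ∣ ∣ z ∣)) ,
  (λ where (there x∈y) → Py x∈y) ,
  (λ where here → Q0
           (there x∈z) → Qz x∈z)

-- At most one x equals `c`; the other elements fall into two classes, and the larger class has at
-- least half of them. The 1 accounts for `c` itself.
majority : ∀ {n} {P Q : Fin n → Set} c (p : Subset n) →
           (∀ {x} → x ∈ p → c ≡ x ⊎ P x ⊎ Q x) →
           ∃[ r ] (∣ p ∣ ≤ 1 + 2 * ∣ r ∣
                × ((∀ {x} → x ∈ r → P x) ⊎ (∀ {x} → x ∈ r → Q x)))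
majority c p c⊎P⊎Q with split p c⊎P⊎Q
... | e , q , ∣p∣≡ , ≡c , P⊎Q with split q P⊎Q
... | y , z , ∣q∣≡ , Py , Qz with ≤-total ∣ y ∣ ∣ z ∣
... | inj₁ y≤z = z , bound , inj₂ Qz
  where
  open ≤-Reasoning
  bound : ∣ p ∣ ≤ 1 + 2 * ∣ z ∣
  bound = begin
    ∣ p ∣                     ≡⟨ trans ∣p∣≡ (cong (∣ e ∣ +_) ∣q∣≡) ⟩
    ∣ e ∣ + (∣ y ∣ + ∣ z ∣)   ≤⟨ +-mono-≤ (all≡⇒∣p∣≤1 e c ≡c) (+-monoˡ-≤ ∣ z ∣ y≤z) ⟩
    1 + (∣ z ∣ + ∣ z ∣)       ≡⟨ cong (λ w → 1 + (∣ z ∣ + w)) (+-identityʳ ∣ z ∣) ⟨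
    1 + 2 * ∣ z ∣             ∎
... | inj₂ z≤y = y , bound , inj₁ Py
  where
  open ≤-Reasoning
  bound : ∣ p ∣ ≤ 1 + 2 * ∣ y ∣
  bound = begin
    ∣ p ∣                     ≡⟨ trans ∣p∣≡ (cong (∣ e ∣ +_) ∣q∣≡) ⟩
    ∣ e ∣ + (∣ y ∣ + ∣ z ∣)   ≤⟨ +-mono-≤ (all≡⇒∣p∣≤1 e c ≡c) (+-monoʳ-≤ ∣ y ∣ z≤y) ⟩
    1 + (∣ y ∣ + ∣ y ∣)       ≡⟨ cong (λ w → 1 + (∣ y ∣ + w)) (+-identityʳ ∣ y ∣) ⟨
    1 + 2 * ∣ y ∣             ∎

-- Disjointness makes representatives of different sets different. The set containing each k is kept
-- in the conclusion, because the induction uses it to see that the next representative is new.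
distinctRepresentatives :
  ∀ {n} {P : Fin n → Set} (M : List (Subset n)) → AllPairs Disjoint M →
  (∀ {S} → S ∈ˡ M → ∃[ k ] (k ∈ S × P k)) →
  ∃[ D ] (length M ≤ ∣ D ∣ × (∀ {k} → k ∈ D → P k × ∃[ S ] (S ∈ˡ M × k ∈ S)))
distinctRepresentatives [] _ _ = ⊥ , z≤n , λ k∈⊥ → ⊥-elim (∉⊥ k∈⊥)
distinctRepresentatives {P = P} (S ∷ M) (S∩M ∷ disj) rep
  with rep (here refl) | distinctRepresentatives M disj (rep ∘ there)
... | k , k∈S , Pk | D , ∣M∣≤∣D∣ , D⇒ =
  D ∪ ⁅ k ⁆ , ≤-trans (s≤s ∣M∣≤∣D∣) (x∉p⇒∣p∣<∣p∪⁅x⁆∣ D k∉D) , D∪k⇒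
  where
  k∉D : k ∉ D
  k∉D k∈D with D⇒ k∈D
  ... | _ , S′ , S′∈M , k∈S′ = All.lookup S∩M S′∈M (k , x∈p∩q⁺ (k∈S , k∈S′))

  D∪k⇒ : ∀ {x} → x ∈ D ∪ ⁅ k ⁆ → P x × ∃[ S′ ] (S′ ∈ˡ S ∷ M × x ∈ S′)
  D∪k⇒ x∈ with x∈p∪q⁻ D ⁅ k ⁆ x∈
  ... | inj₁ x∈D with D⇒ x∈D
  ...   | Px , S′ , S′∈M , x∈S′ = Px , S′ , there S′∈M , x∈S′
  D∪k⇒ x∈ | inj₂ x∈k with refl ← x∈⁅y⁆⇒x≡y k x∈k = Pk , S , here refl , k∈S

-- Double counting

indicator : Bool → ℕ
indicator true  = 1
indicator false = 0

∣p∣≡∑ : ∀ {n} (p : Subset n) → ∣ p ∣ ≡ ∑[ i < n ] indicator (lookup p i)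
∣p∣≡∑ []            = refl
∣p∣≡∑ (outside ∷ p) = ∣p∣≡∑ p
∣p∣≡∑ (inside  ∷ p) = cong suc (∣p∣≡∑ p)

sum-mono-≤ : ∀ {n} {f g : Fin n → ℕ} → (∀ i → f i ≤ g i) → sum f ≤ sum g
sum-mono-≤ {zero}  f≤g = z≤n
sum-mono-≤ {suc n} f≤g = +-mono-≤ (f≤g zero) (sum-mono-≤ (f≤g ∘ suc))

∃-aboveAverage : ∀ {n} (f : Fin (suc n) → ℕ) → ∃[ k ] (sum f ≤ suc n * f k)
∃-aboveAverage {zero}  f = zero , ≤-refl
∃-aboveAverage {suc n} f with ∃-aboveAverage (f ∘ suc)
... | k , sum≤ with f zero ≤? f (suc k)
...   | yes f0≤fk = suc k , +-mono-≤ f0≤fk sum≤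
...   | no  f0≰fk = zero , +-monoʳ-≤ (f zero) (≤-trans sum≤ (*-monoʳ-≤ (suc n) (≰⇒≥ f0≰fk)))

column : ∀ {m n} → Subset m → (Fin m → Subset n) → Fin n → Subset m
column B D k = tabulate (λ b → lookup B b ∧ lookup (D b) k)

∈-column⁻ : ∀ {m n} (B : Subset m) (D : Fin m → Subset n) k {b} →
            b ∈ column B D k → b ∈ B × k ∈ D b
∈-column⁻ B D k {b} b∈ with lookup B b in eqB | lookup (D b) k in eqD
  | trans (sym (lookup∘tabulate (λ b → lookup B b ∧ lookup (D b) k) b)) ([]=⇒lookup b∈)
... | true  | true  | _  = lookup⇒[]= b B eqB , lookup⇒[]= k (D b) eqD
... | true  | false | ()
... | false | _     | ()

-- Pairs (b , k) with b in `B` and k in `D b` are counted twice: every row has at least N / L of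
-- them, and some column is at least as large as the average. Products replace the quotients.
∃-largeColumn : ∀ {m n} (B : Subset m) (D : Fin m → Subset (suc n)) N L →
                (∀ b → N ≤ ∣ D b ∣ * L) →
                ∃₂ λ k X → ∣ B ∣ * N ≤ suc n * ∣ X ∣ * L × (∀ {b} → b ∈ X → b ∈ B × k ∈ D b)
∃-largeColumn {m} {n} B D N L N≤ with ∃-aboveAverage (λ k → ∣ column B D k ∣)
... | k , sum≤ = k , column B D k , count , ∈-column⁻ B D k
  where
  open ≤-Reasoning

  entry : Fin m → Fin (suc n) → ℕ
  entry b j = indicator (lookup B b ∧ lookup (D b) j)

  row : ∀ b → indicator (lookup B b) * N ≤ (∑[ j < suc n ] entry b j) * L
  row b with lookup B b
  ... | false = z≤n
  ... | true  = subst (_≤ _) (sym (+-identityʳ N))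
                  (subst (λ s → N ≤ s * L) (∣p∣≡∑ (D b)) (N≤ b))

  col : ∀ j → ∣ column B D j ∣ ≡ ∑[ b < m ] entry b j
  col j = trans (∣p∣≡∑ (column B D j))
                (sum-cong-≗ (λ b → cong indicator (lookup∘tabulate (λ b → lookup B b ∧ lookup (D b) j) b)))

  count : ∣ B ∣ * N ≤ suc n * ∣ column B D k ∣ * L
  count = begin
    ∣ B ∣ * N                                       ≡⟨ cong (_* N) (∣p∣≡∑ B) ⟩
    (∑[ b < m ] indicator (lookup B b)) * N         ≡⟨ *-distribʳ-sum N (indicator ∘ lookup B) ⟩
    ∑[ b < m ] (indicator (lookup B b) * N)         ≤⟨ sum-mono-≤ row ⟩
    ∑[ b < m ] ((∑[ j < suc n ] entry b j) * L)     ≡⟨ *-distribʳ-sum L (λ b → ∑[ j < suc n ] entry b j) ⟨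
    (∑[ b < m ] ∑[ j < suc n ] entry b j) * L       ≡⟨ cong (_* L) (∑-comm entry) ⟩
    (∑[ j < suc n ] ∑[ b < m ] entry b j) * L       ≡⟨ cong (_* L) (sum-cong-≗ col) ⟨
    (∑[ j < suc n ] ∣ column B D j ∣) * L           ≤⟨ *-monoˡ-≤ L sum≤ ⟩
    suc n * ∣ column B D k ∣ * L                    ∎

-- Derivations in a spanoid

module _ {n : ℕ} {𝒮 : Spanoid n} where

  Reach-⊇ : ∀ {T U} → Reach 𝒮 T U → T ⊆ U
  Reach-⊇ start          = id
  Reach-⊇ (step {U = U} {j = j} T⟶U _ _) = p⊆p∪q ⁅ j ⁆ ∘ Reach-⊇ T⟶U

  -- The second derivation is replayed on top of the first: its rules stay applicable because the
  -- reached set only grows.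
  Reach-join : ∀ {T U V} → Reach 𝒮 T U → Reach 𝒮 T V →
               ∃[ W ] (Reach 𝒮 T W × U ⊆ W × V ⊆ W)
  Reach-join {U = U} T⟶U start = U , T⟶U , id , Reach-⊇ T⟶U
  Reach-join T⟶U (step {U = V} {j = j} T⟶V S⊆V S→j) with Reach-join T⟶U T⟶V
  ... | W , T⟶W , U⊆W , V⊆W =
    W ∪ ⁅ j ⁆ , step T⟶W (V⊆W ∘ S⊆V) S→j , p⊆p∪q ⁅ j ⁆ ∘ U⊆W , Vj⊆Wj
    where
    Vj⊆Wj : V ∪ ⁅ j ⁆ ⊆ W ∪ ⁅ j ⁆
    Vj⊆Wj x∈ with x∈p∪q⁻ V ⁅ j ⁆ x∈
    ... | inj₁ x∈V = p⊆p∪q ⁅ j ⁆ (V⊆W x∈V)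
    ... | inj₂ x∈j = q⊆p∪q W ⁅ j ⁆ x∈j

  ∈⇒⊨ : ∀ {T i} → i ∈ T → T ⊨[ 𝒮 ] i
  ∈⇒⊨ {T} i∈T = T , start , i∈T

  ⊨-pairRule : ∀ {T S i j k} → (∀ {x} → x ∈ S → x ≡ j ⊎ x ≡ k) → 𝒮 S i →
               T ⊨[ 𝒮 ] j → T ⊨[ 𝒮 ] k → T ⊨[ 𝒮 ] i
  ⊨-pairRule {T} {S} {i} S≡jk S→i (U , T⟶U , j∈U) (V , T⟶V , k∈V) with Reach-join T⟶U T⟶V
  ... | W , T⟶W , U⊆W , V⊆W = W ∪ ⁅ i ⁆ , step T⟶W S⊆W S→i , q⊆p∪q W ⁅ i ⁆ (x∈⁅x⁆ i)
    where
    S⊆W : S ⊆ W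
    S⊆W x∈S with S≡jk x∈S
    ... | inj₁ refl = U⊆W j∈U
    ... | inj₂ refl = V⊆W k∈V

-- "A together with y spans b".  Quantifying over all T ⊇ A makes this relation
-- transitive in (y , b) and monotone in A without a cut lemma for Reach.
Link : ∀ {n} → Spanoid n → Subset n → Fin n → Fin n → Set
Link 𝒮 A y b = ∀ {T} → A ⊆ T → T ⊨[ 𝒮 ] y → T ⊨[ 𝒮 ] b

RootedBy : ∀ {n} → Spanoid n → Subset n → Subset n → Set
RootedBy 𝒮 A B = ∀ j → ∃[ y ] (y ∈ B × Link 𝒮 A y j)

RootedBy⇒Spans : ∀ {n} {𝒮 : Spanoid n} {A B} → RootedBy 𝒮 A B → Spans 𝒮 (A ∪ B)
RootedBy⇒Spans {A = A} {B} rooted j with rooted j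
... | y , y∈B , link = link (p⊆p∪q B) (∈⇒⊨ (q⊆p∪q A B y∈B))

-- From a deleted root one steps to a ≺-smaller root, again and again; well-foundedness ends the
-- walk at a surviving root, and the links compose along it. A common order for all of `R` excludes
-- cycles of roots that depend only on each other.
deleteRoots :
  ∀ {n} {𝒮 : Spanoid n} {A B R} {_≺_ : Fin n → Fin n → Set} → WellFounded _≺_ →
  RootedBy 𝒮 A B → (∀ {b} → b ∈ R → ∃[ y ] (y ∈ B × y ≺ b × Link 𝒮 A y b)) →
  RootedBy 𝒮 A (B ─ R)
deleteRoots {𝒮 = 𝒮} {A} {B} {R} {_≺_} wf rooted prev j with rooted j
... | b , b∈B , link with ascend b (wf b) b∈B
  where
  ascend : ∀ b → Acc _≺_ b → b ∈ B → ∃[ y ] (y ∈ B ─ R × Link 𝒮 A y b)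
  ascend b (acc rs) b∈B with b ∈? R
  ... | no  b∉R = b , x∈p∧x∉q⇒x∈p─q b∈B b∉R , λ _ → id
  ... | yes b∈R with prev b∈R
  ...   | y , y∈B , y≺b , link with ascend y (rs y≺b) y∈B
  ...     | z , z∈ , link′ = z , z∈ , λ A⊆T → link A⊆T ∘ link′ A⊆T
... | y , y∈ , link′ = y , y∈ , λ A⊆T → link A⊆T ∘ link′ A⊆T

-- Numerical estimates

-- Here β counts the roots, c the large column and ρ the deleted roots. The first two hypotheses
-- give 2β ≤ 4Lρ + 2L, and the third absorbs 2L into one β. Hence at least a fraction 1 / (4L) of
-- the roots is deleted.
deletedFraction : ∀ {β c ρ L} n → β * suc n ≤ suc n * c * L → c ≤ 1 + 2 * ρ → 2 * L ≤ β →
                  β ≤ 4 * L * ρ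
deletedFraction {β} {c} {ρ} {L} n count c≤ 2L≤β = +-cancelʳ-≤ β β (4 * L * ρ) (begin
  β + β                       ≡⟨ cong (β +_) (+-identityʳ β) ⟨
  2 * β                       ≤⟨ *-monoʳ-≤ 2 β≤cL ⟩
  2 * (c * L)                 ≤⟨ *-monoʳ-≤ 2 (*-monoˡ-≤ L c≤) ⟩
  2 * ((1 + 2 * ρ) * L)       ≡⟨ expand ρ L ⟩
  4 * L * ρ + 2 * L           ≤⟨ +-monoʳ-≤ (4 * L * ρ) 2L≤β ⟩
  4 * L * ρ + β               ∎)
  where
  open ≤-Reasoning
  expand : ∀ ρ L → 2 * ((1 + 2 * ρ) * L) ≡ 4 * L * ρ + 2 * L
  expand = solve-∀
  β≤cL : β ≤ c * L
  β≤cL = *-cancelʳ-≤ β (c * L) (suc n)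
    (≤-trans count (≤-reflexive (trans (*-assoc (suc n) c L) (*-comm (suc n) (c * L)))))

-- The left side consists of the first two terms of the binomial expansion; this is Bernoulli's
-- inequality for 1 + y / x with denominators cleared.
bernoulli : ∀ x y m → x ^ suc m + suc m * y * x ^ m ≤ (x + y) ^ suc m
bernoulli x y zero    = ≤-reflexive (base x y)
  where
  base : ∀ x y → x * 1 + (y + 0) * 1 ≡ (x + y) * 1
  base = solve-∀
bernoulli x y (suc m) = begin
  -- The term added here is the surplus in y² when the induction hypothesis is multiplied by x + y.
  x * (x * X) + suc (suc m) * y * (x * X)                      ≤⟨ m≤m+n _ _ ⟩
  x * (x * X) + suc (suc m) * y * (x * X) + y * (suc m * y * X) ≡⟨ regroup x y (suc m) X ⟩
  (x + y) * (x * X + suc m * y * X)                            ≤⟨ *-monoʳ-≤ (x + y) (bernoulli x y m) ⟩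
  (x + y) * (x + y) ^ suc m                                    ∎
  where
  open ≤-Reasoning
  X = x ^ m
  regroup : ∀ x y s X → x * (x * X) + (1 + s) * y * (x * X) + y * (s * y * X)
                      ≡ (x + y) * (x * X + s * y * X)
  regroup = solve-∀

-- If x ≤ N y, the second binomial term N y x^(N-1) is already at least x^N.
x≤Ny⇒2x^N≤[x+y]^N : ∀ {x y} N → 0 < N → x ≤ N * y → 2 * x ^ N ≤ (x + y) ^ N
x≤Ny⇒2x^N≤[x+y]^N {x} {y} (suc m) _ x≤Ny = begin
  2 * x ^ suc m                      ≡⟨ cong (x ^ suc m +_) (+-identityʳ (x ^ suc m)) ⟩
  x ^ suc m + x * x ^ m              ≤⟨ +-monoʳ-≤ (x ^ suc m) (*-monoˡ-≤ (x ^ m) x≤Ny) ⟩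
  x ^ suc m + suc m * y * x ^ m      ≤⟨ bernoulli x y m ⟩
  (x + y) ^ suc m                    ∎
  where open ≤-Reasoning

-- One round of deletion and its iteration, for tolerance 1 / L

module _ {n : ℕ} {𝒮 : Spanoid (suc n)} {L : ℕ} (0<L : 0 < L) (lcs : IsLCS 𝒮 2 1 L) where

  private
    N = suc n

  module _ {A B : Subset N} (rooted : RootedBy 𝒮 A B) where

    private
      root : Fin N → Fin N
      root j = proj₁ (rooted j)

      -- The relation is a parameter: a rule yields only y ≢ b, which is later refined to < or >,
      -- the relations along which roots can be deleted.
      RedundantVia : (Fin N → Fin N → Set) → Fin N → Fin N → Set
      RedundantVia _≺_ k b = ∃[ y ] (y ∈ B × y ≺ b × Link 𝒮 (A ∪ ⁅ k ⁆) y b)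

      Redundant : Fin N → Fin N → Set
      Redundant = RedundantVia _≢_

      -- If the root of one element of the pair is b, that element is chosen; otherwise the other
      -- one is, and it makes b redundant. The first outcome costs little: a fixed k has a single
      -- root, so it arises for at most one b.
      representative : ∀ b {S} → ∣ S ∣ ≡ 2 → 𝒮 S b →
                       ∃[ k ] (k ∈ S × (root k ≡ b ⊎ Redundant k b))
      representative b {S} ∣S∣≡2 S→b with ∣p∣≡2⇒pair S ∣S∣≡2
      ... | j , k , j∈S , k∈S , S≡jk with rooted j in eq
      ...   | y , y∈B , link with y ≟ᶠ b
      ...     | yes y≡b = j , j∈S , inj₁ (trans (cong proj₁ eq) y≡b)
      ...     | no  y≢b = k , k∈S , inj₂ (y , y∈B , y≢b , λ Ak⊆T T⊨y →
        ⊨-pairRule S≡jk S→b (link (Ak⊆T ∘ p⊆p∪q ⁅ k ⁆) T⊨y)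
                            (∈⇒⊨ (Ak⊆T (q⊆p∪q A ⁅ k ⁆ (x∈⁅x⁆ k)))))

      choices : ∀ b → ∃[ D ] (N ≤ ∣ D ∣ * L × (∀ {k} → k ∈ D → root k ≡ b ⊎ Redundant k b))
      choices b with lcs b
      ... | M , sizes , disjoint , rules , N≤
        with distinctRepresentatives M disjoint
               (λ S∈M → representative b (All.lookup sizes S∈M) (All.lookup rules S∈M))
      ... | D , ∣M∣≤∣D∣ , D⇒ =
        D , ≤-trans (≤-reflexive (sym (*-identityˡ N))) (≤-trans N≤ (*-monoˡ-≤ L ∣M∣≤∣D∣)) ,
        proj₁ ∘ D⇒

      largeColumn : ∃₂ λ k X → ∣ B ∣ * N ≤ N * ∣ X ∣ * L
                             × (∀ {b} → b ∈ X → b ∈ B × (root k ≡ b ⊎ Redundant k b))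
      largeColumn =
        let k , X , count , X⇒ = ∃-largeColumn B (proj₁ ∘ choices) N L (proj₁ ∘ proj₂ ∘ choices)
        in k , X , count , λ {b} b∈X →
             proj₁ (X⇒ b∈X) , proj₂ (proj₂ (choices b)) (proj₂ (X⇒ b∈X))

      Removable : (Fin N → Fin N → Set) → Fin N → Fin N → Set
      Removable _≺_ k b = b ∈ B × RedundantVia _≺_ k b

      sorted : ∀ {c k b} → b ∈ B × (c ≡ b ⊎ Redundant k b) →
               c ≡ b ⊎ Removable _<ᶠ_ k b ⊎ Removable _>ᶠ_ k b
      sorted (_ , inj₁ c≡b) = inj₁ c≡b
      sorted {b = b} (b∈B , inj₂ (y , y∈B , y≢b , link)) with <-cmp y b
      ... | tri< y<b _ _ = inj₂ (inj₁ (b∈B , y , y∈B , y<b , link))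
      ... | tri≈ _ y≡b _ = ⊥-elim (y≢b y≡b)
      ... | tri> _ _ y>b = inj₂ (inj₂ (b∈B , y , y∈B , y>b , link))

      rooted⁺ : ∀ k → RootedBy 𝒮 (A ∪ ⁅ k ⁆) B
      rooted⁺ k j with rooted j
      ... | y , y∈B , link = y , y∈B , λ Ak⊆T → link (Ak⊆T ∘ p⊆p∪q ⁅ k ⁆)

      pruned : ∀ {k R} {_≺_ : Fin N → Fin N → Set} → WellFounded _≺_ →
               (∀ {b} → b ∈ R → Removable _≺_ k b) → RootedBy 𝒮 (A ∪ ⁅ k ⁆) (B ─ R)
      pruned {k} wf R⇒ = deleteRoots wf (rooted⁺ k) (proj₂ ∘ R⇒)

      RemovableSet : Fin N → Subset N → Set
      RemovableSet k R = (∀ {b} → b ∈ R → Removable _<ᶠ_ k b)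
                       ⊎ (∀ {b} → b ∈ R → Removable _>ᶠ_ k b)

      remove : ∀ k R → RemovableSet k R →
               RootedBy 𝒮 (A ∪ ⁅ k ⁆) (B ─ R) × ∣ B ─ R ∣ + ∣ R ∣ ≡ ∣ B ∣
      remove k R (inj₁ R⇒) = pruned <-wellFounded R⇒ , q⊆p⇒∣p─q∣+∣q∣≡∣p∣ B R (proj₁ ∘ R⇒)
      remove k R (inj₂ R⇒) = pruned >-wellFounded R⇒ , q⊆p⇒∣p─q∣+∣q∣≡∣p∣ B R (proj₁ ∘ R⇒)

      shrinkVia : ∀ k X → ∣ B ∣ * N ≤ N * ∣ X ∣ * L →
                  (∀ {b} → b ∈ X → b ∈ B × (root k ≡ b ⊎ Redundant k b)) → 2 * L ≤ ∣ B ∣ →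
                  ∃[ B′ ] (RootedBy 𝒮 (A ∪ ⁅ k ⁆) B′
                         × ∃[ ρ ] (∣ B′ ∣ + ρ ≡ ∣ B ∣ × ∣ B ∣ ≤ 4 * L * ρ))
      shrinkVia k X count X⇒ 2L≤∣B∣ =
        let R , ∣X∣≤ , R⇒        = majority (root k) X (sorted ∘ X⇒)
            rooted′ , ∣B─R∣+∣R∣≡ = remove k R R⇒
        in B ─ R , rooted′ , ∣ R ∣ , ∣B─R∣+∣R∣≡ ,
           deletedFraction {∣ B ∣} {∣ X ∣} {∣ R ∣} {L} n count ∣X∣≤ 2L≤∣B∣

    shrink : 2 * L ≤ ∣ B ∣ →
             ∃₂ λ k B′ → RootedBy 𝒮 (A ∪ ⁅ k ⁆) B′
                       × ∃[ ρ ] (∣ B′ ∣ + ρ ≡ ∣ B ∣ × ∣ B ∣ ≤ 4 * L * ρ)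
    shrink 2L≤∣B∣ =
      let k , X , count , X⇒ = largeColumn
      in k , shrinkVia k X count X⇒ 2L≤∣B∣

  -- For nonempty `B` this says ∣A∣ ≤ 4L log₂ (N / ∣B∣), written with powers to remain in ℕ.
  Potential : Subset N → Subset N → Set
  Potential A B = 2 ^ ∣ A ∣ * ∣ B ∣ ^ (4 * L) ≤ N ^ (4 * L)

  private
    0<4L : 0 < 4 * L
    0<4L = ≤-trans 0<L (m≤m+n L _)

  -- The new element at most doubles 2^∣A∣, while deleting a fraction 1 / (4L) of the roots at least
  -- halves ∣B∣^(4L).
  potential-step : ∀ {A B B′ k ρ} → ∣ B′ ∣ + ρ ≡ ∣ B ∣ → ∣ B ∣ ≤ 4 * L * ρ →
                   Potential A B → Potential (A ∪ ⁅ k ⁆) B′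
  potential-step {A} {B} {B′} {k} {ρ} B′+ρ≡B B≤4Lρ pot = begin
    2 ^ ∣ A ∪ ⁅ k ⁆ ∣ * b′ ^ (4 * L)   ≤⟨ *-monoˡ-≤ (b′ ^ (4 * L)) (^-monoʳ-≤ 2 (∣p∪⁅x⁆∣≤1+∣p∣ A k)) ⟩
    2 * 2 ^ ∣ A ∣ * b′ ^ (4 * L)       ≡⟨ cong (_* b′ ^ (4 * L)) (*-comm 2 (2 ^ ∣ A ∣)) ⟩
    2 ^ ∣ A ∣ * 2 * b′ ^ (4 * L)       ≡⟨ *-assoc (2 ^ ∣ A ∣) 2 (b′ ^ (4 * L)) ⟩
    2 ^ ∣ A ∣ * (2 * b′ ^ (4 * L))     ≤⟨ *-monoʳ-≤ (2 ^ ∣ A ∣) (x≤Ny⇒2x^N≤[x+y]^N (4 * L) 0<4L b′≤4Lρ) ⟩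
    2 ^ ∣ A ∣ * (b′ + ρ) ^ (4 * L)     ≡⟨ cong (λ b → 2 ^ ∣ A ∣ * b ^ (4 * L)) B′+ρ≡B ⟩
    2 ^ ∣ A ∣ * ∣ B ∣ ^ (4 * L)        ≤⟨ pot ⟩
    N ^ (4 * L)                        ∎
    where
    open ≤-Reasoning
    b′ = ∣ B′ ∣
    b′≤4Lρ : b′ ≤ 4 * L * ρ
    b′≤4Lρ = ≤-trans (m≤m+n b′ ρ) (≤-trans (≤-reflexive B′+ρ≡B) B≤4Lρ)

  -- With ρ = 0 one would have 2L ≤ β ≤ 0. The strict decrease lets ∣B∣ bound the number of rounds.
  strictlyFewer : ∀ {β β′ ρ} → 2 * L ≤ β → β′ + ρ ≡ β → β ≤ 4 * L * ρ → β′ < β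
  strictlyFewer {ρ = zero} 2L≤β _ β≤ =
    ⊥-elim (<⇒≱ 0<L (≤-trans (m≤m+n L _)
      (≤-trans 2L≤β (≤-trans β≤ (≤-reflexive (*-zeroʳ (4 * L)))))))
  strictlyFewer {β′ = β′} {suc ρ} _ β′+ρ≡β _ =
    ≤-trans (m<m+n β′ (s≤s z≤n)) (≤-reflexive β′+ρ≡β)

  iterate : ∀ fuel A B → ∣ B ∣ ≤ fuel → RootedBy 𝒮 A B → Potential A B →
            ∃₂ λ A B → RootedBy 𝒮 A B × ∣ B ∣ ≤ 2 * L × Potential A B
  -- Without fuel `B` is empty, so the target size 2L is met trivially.
  iterate zero A B ∣B∣≤0 rooted pot = A , B , rooted , ≤-trans ∣B∣≤0 z≤n , pot
  iterate (suc fuel) A B ∣B∣≤fuel rooted pot with 2 * L ≤? ∣ B ∣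
  ... | no  2L≰∣B∣ = A , B , rooted , ≰⇒≥ 2L≰∣B∣ , pot
  ... | yes 2L≤∣B∣ =
    let k , B′ , rooted′ , ρ , ∣B′∣+ρ≡∣B∣ , ∣B∣≤ = shrink rooted 2L≤∣B∣
    in iterate fuel (A ∪ ⁅ k ⁆) B′
         (≤-pred (≤-trans (strictlyFewer {∣ B ∣} {∣ B′ ∣} {ρ} 2L≤∣B∣ ∣B′∣+ρ≡∣B∣ ∣B∣≤) ∣B∣≤fuel))
         rooted′
         (potential-step {A} {B} {B′} {k} {ρ} ∣B′∣+ρ≡∣B∣ ∣B∣≤ pot)

  potential₀ : Potential ⊥ ⊤
  potential₀ = ≤-reflexive (begin-equality
    2 ^ ∣ ⊥ {N} ∣ * ∣ ⊤ {N} ∣ ^ (4 * L) ≡⟨ cong (λ a → 2 ^ a * ∣ ⊤ {N} ∣ ^ (4 * L)) (∣⊥∣≡0 N) ⟩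
    1 * ∣ ⊤ {N} ∣ ^ (4 * L)             ≡⟨ *-identityˡ _ ⟩
    ∣ ⊤ {N} ∣ ^ (4 * L)                 ≡⟨ cong (_^ (4 * L)) (∣⊤∣≡n N) ⟩
    N ^ (4 * L)                         ∎)
    where open ≤-Reasoning

  -- The exponent 6L is 4L + 2L: the potential bounds 2^∣A∣ by N^(4L), and 2^∣B∣ ≤ 2^(2L) ≤ N^(2L)
  -- as N ≥ 2.
  finalBound : ∀ A B → 2 ≤ N → RootedBy 𝒮 A B → ∣ B ∣ ≤ 2 * L → Potential A B →
               2 ^ ∣ A ∪ B ∣ ≤ N ^ (6 * L)
  finalBound A B 2≤N rooted ∣B∣≤2L pot = begin
    2 ^ ∣ A ∪ B ∣                ≤⟨ ^-monoʳ-≤ 2 (∣p∪q∣≤∣p∣+∣q∣ A B) ⟩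
    2 ^ (∣ A ∣ + ∣ B ∣)          ≡⟨ ^-distribˡ-+-* 2 ∣ A ∣ ∣ B ∣ ⟩
    2 ^ ∣ A ∣ * 2 ^ ∣ B ∣        ≤⟨ *-mono-≤ 2^∣A∣≤ 2^∣B∣≤ ⟩
    N ^ (4 * L) * N ^ (2 * L)    ≡⟨ ^-distribˡ-+-* N (4 * L) (2 * L) ⟨
    N ^ (4 * L + 2 * L)          ≡⟨ cong (N ^_) (*-distribʳ-+ L 4 2) ⟨
    N ^ (6 * L)                  ∎
    where
    open ≤-Reasoning

    2^∣B∣≤ : 2 ^ ∣ B ∣ ≤ N ^ (2 * L)
    2^∣B∣≤ = ≤-trans (^-monoʳ-≤ 2 ∣B∣≤2L) (^-monoˡ-≤ (2 * L) 2≤N)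

    0<∣B∣ : 0 < ∣ B ∣
    0<∣B∣ = x∈p⇒0<∣p∣ (proj₁ (proj₂ (rooted zero)))

    2^∣A∣≤ : 2 ^ ∣ A ∣ ≤ N ^ (4 * L)
    2^∣A∣≤ = ≤-trans
      (m≤m*n (2 ^ ∣ A ∣) (∣ B ∣ ^ (4 * L)) ⦃ m^n≢0 ∣ B ∣ (4 * L) ⦃ >-nonZero 0<∣B∣ ⦄ ⦄) pot

  smallSpanningSet : 2 ≤ N → ∃[ T ] (Spans 𝒮 T × 2 ^ ∣ T ∣ ≤ N ^ (6 * L))
  smallSpanningSet 2≤N =
    let A , B , rooted , ∣B∣≤2L , pot =
          iterate N ⊥ ⊤ (∣p∣≤n {N} ⊤) (λ j → j , ∈⊤ , λ _ → id) potential₀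
    in A ∪ B , RootedBy⇒Spans rooted , finalBound A B 2≤N rooted ∣B∣≤2L pot

-- Members of size 2 are nonempty, so they have distinct representatives in [n]. This forces a ≤ b,
-- that is δ ≤ 1.
disjointFamily-bound : ∀ {n} (M : List (Subset n)) → AllPairs Disjoint M →
                       All (λ S → ∣ S ∣ ≡ 2) M → length M ≤ n
disjointFamily-bound M disjoint sizes
  with distinctRepresentatives {P = λ _ → 𝟙} M disjoint nonempty
  where
  nonempty : ∀ {S} → S ∈ˡ M → ∃[ k ] (k ∈ S × 𝟙)
  nonempty {S} S∈M with ∣p∣≡2⇒pair S (All.lookup sizes S∈M)
  ... | j , _ , j∈S , _ = j , j∈S , tt
... | D , ∣M∣≤∣D∣ , _ = ≤-trans ∣M∣≤∣D∣ (∣p∣≤n D)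

-- The tolerance a / b is replaced by 1 / L with L = ⌊b / a⌋ + 1, at the cost of a factor 2.
mainTheorem1 : ∃[ C ] (0 < C × (∀ (n : ℕ) → 2 ≤ n → ∀ (a b : ℕ) → 0 < a → 0 < b →
    (𝒮 : Spanoid n) → IsLCS 𝒮 2 a b →
    ∃[ T ] (Spans 𝒮 T × 2 ^ (∣ T ∣ * a) ≤ n ^ (C * b))))
mainTheorem1 = 12 , s≤s z≤n , bound
  where
  open ≤-Reasoning

  bound : ∀ (n : ℕ) → 2 ≤ n → ∀ (a b : ℕ) → 0 < a → 0 < b →
          (𝒮 : Spanoid n) → IsLCS 𝒮 2 a b →
          ∃[ T ] (Spans 𝒮 T × 2 ^ (∣ T ∣ * a) ≤ n ^ (12 * b))
  -- The bound for tolerance 1 / L is raised to the power a. In logarithms the result is ∣T∣ ≤ 12 (b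
  -- / a) log₂ n.
  bound n@(suc _) 2≤n a@(suc _) b 0<a 0<b 𝒮 lcs = T , spans , (begin
    2 ^ (∣ T ∣ * a)      ≡⟨ ^-*-assoc 2 ∣ T ∣ a ⟨
    (2 ^ ∣ T ∣) ^ a      ≤⟨ ^-monoˡ-≤ a small ⟩
    (n ^ (6 * L)) ^ a    ≡⟨ ^-*-assoc n (6 * L) a ⟩
    n ^ (6 * L * a)      ≤⟨ ^-monoʳ-≤ n 6La≤12b ⟩
    n ^ (12 * b)         ∎)
    where
    L = suc (b / a)

    a≤b : a ≤ b
    a≤b with lcs zero
    ... | M , sizes , disjoint , _ , an≤ = *-cancelʳ-≤ a b n (begin
      a * n          ≤⟨ an≤ ⟩
      length M * b   ≤⟨ *-monoˡ-≤ b (disjointFamily-bound M disjoint sizes) ⟩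
      n * b          ≡⟨ *-comm n b ⟩
      b * n          ∎)

    -- Since 1 / L ≤ a / b, the given families are also large enough for tolerance 1 / L.
    b≤La : b ≤ L * a
    b≤La = begin
      b                    ≡⟨ m≡m%n+[m/n]*n b a ⟩
      b % a + b / a * a    ≤⟨ +-monoˡ-≤ (b / a * a) (<⇒≤ (m%n<n b a)) ⟩
      L * a                ∎

    6La≤12b : 6 * L * a ≤ 12 * b
    6La≤12b = begin
      6 * L * a      ≡⟨ *-assoc 6 L a ⟩
      -- L a = a + ⌊b / a⌋ a, and each summand is at most b, the first because δ ≤ 1; this doubles 6
      -- to 12.
      6 * (L * a)    ≤⟨ *-monoʳ-≤ 6 (+-mono-≤ a≤b (m/n*n≤m b a)) ⟩
      6 * (b + b)    ≡⟨ double b ⟩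
      12 * b         ∎
      where
      double : ∀ b → 6 * (b + b) ≡ 12 * b
      double = solve-∀

    lcs₁ : IsLCS 𝒮 2 1 L
    lcs₁ i with lcs i
    ... | M , sizes , disjoint , rules , an≤ = M , sizes , disjoint , rules ,
      *-cancelʳ-≤ (1 * n) (length M * L) a (begin
        1 * n * a            ≡⟨ cong (_* a) (*-identityˡ n) ⟩
        n * a                ≡⟨ *-comm n a ⟩
        a * n                ≤⟨ an≤ ⟩
        length M * b         ≤⟨ *-monoʳ-≤ (length M) b≤La ⟩
        length M * (L * a)   ≡⟨ *-assoc (length M) L a ⟨
        length M * L * a     ∎)

    spanning = smallSpanningSet {L = L} (s≤s z≤n) lcs₁ 2≤n
    T        = proj₁ spanning
    spans    = proj₁ (proj₂ spanning)
    small    = proj₂ (proj₂ spanning)
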